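{- Let $r\ge 1$, $s\ge 2$ and $n=rs$. Then $\chi_{la}(G_1(r,s))=3$ and $\chi_{la}(G_2(r,s))=3$.
   Context: For a graph $G=(V,E)$ with $|E|=m$ and no isolated vertices, a local antimagic labeling is a bijection $f:E\to\{1,\dots,m\}$ such that $f^+(u)\ne f^+(v)$ for every edge $uv$, where $f^+(x)=\sum f(e)$ over all edges $e$ incident to $x$. The local antimagic chromatic number $\chi_{la}(G)$ is the minimum, over all local antimagic labelings $f$ of $G$, of the number of distinct values taken by $f^+$ (also for disconnected graphs). Merging a set of vertices means identifying them into one vertex incident to all edges previously incident to any of them. Take $n$ disjoint copies of $C_4(8,2)$ indexed $a=1,\dots,n$, the $a$-th copy having vertices $\{u_{a,i},v_{a,i}:1\le i\le 8\}$ and edges $u_{a,i}u_{a,i+1}$, $v_{a,i}v_{a,i+1}$ ($1\le i\le 8$, second index mod 8) and $u_{a,2j}v_{a,2j}$ ($1\le j\le 4$). $G_1(r,s)$ is obtained by merging, for each $b\in[1,r]$ and each $j\in[1,4]$, the set $\{u_{(b-1)s+i,2j-1}:1\le i\le s\}$ into one vertex and the set $\{v_{(b-1)s+i,2j-1}:1\le i\le s\}$ into one vertex. $G_2(r,s)$ is obtained by merging, for each $b\in[1,r]$, the set $\{u_{(b-1)s+i,2j}:1\le i\le s\}$ into one vertex for each $j\in\{1,4\}$, and the set $\{v_{(b-1)s+i,2j}:1\le i\le s\}$ into one vertex for each $j\in\{2,3\}$. -}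

module Defs where

open import Data.Nat using (ℕ; zero; suc; _+_; _*_; _≤_; _%_; _≡ᵇ_)
open import Data.Nat.DivMod using (_mod_)
open import Data.Bool using (Bool; true; false; if_then_else_; _∧_; _∨_)
open import Data.Fin using (Fin; toℕ; remQuot; splitAt)
import Data.Fin.Properties as FinP
import Data.Nat.Properties as NatP
open import Data.Nat.ListAction using (sum)
open import Data.List using (List; []; _∷_; map; length; deduplicate; concatMap; allFin)
open import Data.Product using (_×_; _,_; proj₁; proj₂; Σ)
open import Data.Sum using (_⊎_; inj₁; inj₂)
import Data.Sum.Properties as SumP
import Data.Product.Properties as ProdP
open import Relation.Binary.Definitions using (DecidableEquality)
open import Relation.Binary.PropositionalEquality using (_≡_; _≢_)
open import Relation.Nullary.Decidable using (⌊_⌋)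
open import Function.Bundles using (_↔_; Inverse)

-- Finite (multi)graphs given by their edge list.  The vertex set of the
-- graph is the set of endpoints of edges (so there are no isolated
-- vertices, as required in the definition of local antimagic labelings).

record Graph : Set₁ where
  field
    V    : Set
    _≟V_ : DecidableEquality V
    m    : ℕ
    ends : Fin m → V × V

open Graph public

Labeling : Graph → Set
Labeling G = Fin (m G) ↔ Fin (m G)

label : (G : Graph) → Labeling G → Fin (m G) → ℕ
label G f e = suc (toℕ (Inverse.to f e))

incidence : (G : Graph) → Fin (m G) → V G → ℕ
incidence G e x =
  (if ⌊ _≟V_ G (proj₁ (ends G e)) x ⌋ then 1 else 0) +
  (if ⌊ _≟V_ G (proj₂ (ends G e)) x ⌋ then 1 else 0)

vsum : (G : Graph) → Labeling G → V G → ℕ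
vsum G f x = sum (map (λ e → incidence G e x * label G f e) (allFin (m G)))

LocalAntimagic : (G : Graph) → Labeling G → Set
LocalAntimagic G f =
  (e : Fin (m G)) → vsum G f (proj₁ (ends G e)) ≢ vsum G f (proj₂ (ends G e))

vertexList : (G : Graph) → List (V G)
vertexList G = concatMap (λ e → proj₁ (ends G e) ∷ proj₂ (ends G e) ∷ []) (allFin (m G))

colours : (G : Graph) → Labeling G → ℕ
colours G f = length (deduplicate NatP._≟_ (map (vsum G f) (vertexList G)))

ChiLaEq : Graph → ℕ → Set
ChiLaEq G k =
  (Σ (Labeling G) λ f → LocalAntimagic G f × colours G f ≡ k) ×
  ((f : Labeling G) → LocalAntimagic G f → k ≤ colours G f)

-- n = r s copies of C_4(8,2), with merged vertices.
-- A vertex is (c , side , i): side 0 = u, 1 = v; i : Fin 8 is the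
-- 0-based index (paper's index i corresponds to toℕ i + 1);
-- c = inj₁ a : an unmerged vertex of copy a (0-based),
-- c = inj₂ b : the merged vertex of block b (0-based) at (side, i).

MVert : ℕ → ℕ → Set
MVert r s = (Fin (r * s) ⊎ Fin r) × Fin 2 × Fin 8

MVert-≟ : (r s : ℕ) → DecidableEquality (MVert r s)
MVert-≟ r s = ProdP.≡-dec (SumP.≡-dec FinP._≟_ FinP._≟_)
                          (ProdP.≡-dec FinP._≟_ FinP._≟_)

next8 : Fin 8 → Fin 8
next8 i = suc (toℕ i) mod 8

-- 0-based position of paper vertex index 2j, for j' = j - 1 : Fin 4
spokePos : Fin 4 → Fin 8
spokePos j = (1 + 2 * toℕ j) mod 8


-- Given a merging rule (which (side,i) get merged within a block),
-- build the graph.  Edge (a , k), k : Fin 20: k < 8: u_{a,k}u_{a,k+1};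
-- 8 ≤ k < 16: v-cycle edge; k = 16 + j': spoke u_{a,2j}v_{a,2j}.
mergedC48 : (r s : ℕ) → (Fin 2 → Fin 8 → Bool) → Graph
mergedC48 r s merge = record
  { V = MVert r s
  ; _≟V_ = MVert-≟ r s
  ; m = (r * s) * 20
  ; ends = λ e → edge (remQuot 20 e)
  }
  where
  vert : Fin (r * s) → Fin 2 → Fin 8 → MVert r s
  vert a sd i with merge sd i
  ... | true  = inj₂ (proj₁ (remQuot {r} s a)) , sd , i
  ... | false = inj₁ a , sd , i
  edge : Fin (r * s) × Fin 20 → MVert r s × MVert r s
  edge (a , k) with splitAt 8 {12} k
  ... | inj₁ i = vert a Fin.zero i , vert a Fin.zero (next8 i)
    where import Data.Fin as Fin
  ... | inj₂ k' with splitAt 8 {4} k'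
  ...   | inj₁ i = vert a (Fin.suc Fin.zero) i , vert a (Fin.suc Fin.zero) (next8 i)
    where import Data.Fin as Fin
  ...   | inj₂ j = vert a Fin.zero (spokePos j) , vert a (Fin.suc Fin.zero) (spokePos j)
    where import Data.Fin as Fin

-- G_1: merge u_{·,2j-1}, v_{·,2j-1} (j=1..4), i.e. 0-based even indices, both sides
merge1 : Fin 2 → Fin 8 → Bool
merge1 sd i = toℕ i % 2 ≡ᵇ 0

-- G_2: merge u_{·,2j} for j ∈ {1,4} (0-based 1,7) and v_{·,2j} for j ∈ {2,3} (0-based 3,5)
merge2 : Fin 2 → Fin 8 → Bool
merge2 sd i with toℕ sd
... | zero  = (toℕ i ≡ᵇ 1) ∨ (toℕ i ≡ᵇ 7)
... | suc _ = (toℕ i ≡ᵇ 3) ∨ (toℕ i ≡ᵇ 5)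

G₁ : ℕ → ℕ → Graph
G₁ r s = mergedC48 r s merge1

G₂ : ℕ → ℕ → Graph
G₂ r s = mergedC48 r s merge2

{-# OPTIONS --safe #-}
module Submission where

-- Upper bound.  The labelling gives every degree-2 vertex of every copy of C₄(8,2) the sum 20n + 1 and every
-- degree-3 vertex 30n + 1 (at the vertices merged in G₂) or 30n + 2, the two values alternating along spokes.
-- Merging multiplies one of the three values by s, and they stay distinct.
-- Lower bound.  With two colours, each class of the bipartition of a block of s copies would be monochromatic
-- (the merged vertices connect the copies).  The two classes have the same size and both have the sum of all
-- labels of the block as total, so their colours would agree.

open import Defs
open import Data.Bool using (Bool; true; false; if_then_else_) renaming (_≟_ to _≟ᵇ_)
open import Data.Fin using (Fin; zero; suc; toℕ; cast; splitAt; combine; remQuot; quotRem; opposite; punchOut; inject₁; _↑ˡ_; _↑ʳ_; #_)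
open import Data.Fin.Patterns
open import Data.Fin.Properties
  using (_≟_; suc-injective; all?; any?; toℕ-injective; toℕ-cast; toℕ-combine; toℕ<n; opposite-prop;
         opposite-involutive; combine-injective; combine-remQuot; remQuot-combine; punchOut-injective; injective⇒≤)
open import Data.List using (List; []; _∷_; _++_; map; length; tabulate; allFin)
open import Data.List.Membership.Propositional using (_∈_; find; lose)
open import Data.List.Membership.Propositional.Properties
  using (∈-∃++; ∈-++⁻; ∈-++⁺ˡ; ∈-++⁺ʳ; ∈-map⁺; ∈-map⁻; ∈-concatMap⁺; ∈-concatMap⁻; ∈-allFin; ∈-deduplicate⁺; ∈-deduplicate⁻)
open import Data.List.Properties using (map-tabulate; length-++-sucʳ)
open import Data.List.Relation.Unary.All as All using ([]; _∷_)
open import Data.List.Relation.Unary.AllPairs using ([]; _∷_)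
open import Data.List.Relation.Unary.Any using (here; there)
open import Data.List.Relation.Unary.Unique.DecPropositional.Properties using (deduplicate-!)
open import Data.List.Relation.Unary.Unique.Propositional using (Unique)
open import Data.Nat using (ℕ; zero; suc; _+_; _*_; _∸_; _≤_; _<_; NonZero; z≤n; s≤s)
open import Data.Nat.ListAction using () renaming (sum to listSum)
open import Data.Nat.Properties as ℕ
  using (+-*-semiring; +-identityʳ; +-assoc; +-suc; *-identityˡ; *-identityʳ; *-zeroʳ; *-assoc; *-comm;
         *-distribˡ-+; *-cancelˡ-≡; m+[n∸m]≡n; ≤-reflexive; ≤-antisym; ≤-trans; <-trans; <-≤-trans; n≮n;
         ≤⇒≯; ≮⇒≥; <⇒≢; >⇒≢; m≤m+n; *-monoˡ-≤; *-monoʳ-≤; +-monoˡ-≤)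
open import Algebra.Properties.Semiring.Sum +-*-semiring
  using (sum; ∑-comm; ∑-distrib-+; *-distribˡ-sum; *-distribʳ-sum; sum-cong-≗; sum-replicate-zero; sum-syntax)
open import Data.Nat.Tactic.RingSolver using (solve-∀)
open import Data.Product using (∃; _×_; _,_; proj₁; proj₂; uncurry)
open import Data.Product.Properties using (≡-dec; ,-injectiveˡ)
open import Data.Sum using (_⊎_; inj₁; inj₂)
open import Data.Sum.Properties using (inj₁-injective; inj₂-injective) renaming (≡-dec to ⊎-≡-dec)
open import Data.Vec using (lookup; []; _∷_)
open import Function using (_∘_; id; mk↔ₛ′; _↔_; Inverse)
open import Function.Definitions using (Injective)
open import Relation.Binary.Definitions using (DecidableEquality)
open import Relation.Binary.PropositionalEquality
  using (_≡_; _≢_; refl; sym; trans; cong; cong₂; subst; subst₂; module ≡-Reasoning)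
open import Relation.Nullary using (¬_; Dec; yes; no; contradiction)
open import Relation.Nullary.Decidable using (⌊_⌋; from-yes; ¬?)

open ≡-Reasoning

-- Indicators and finite sums.

-- The Iverson bracket, in the shape used by `incidence`, so that incidences are sums of two
-- brackets by computation.
⟦_⟧ : {P : Set} → Dec P → ℕ
⟦ P? ⟧ = if ⌊ P? ⌋ then 1 else 0

⟦⟧-cong : {P Q : Set} (P? : Dec P) (Q? : Dec Q) → (P → Q) → (Q → P) → ⟦ P? ⟧ ≡ ⟦ Q? ⟧
⟦⟧-cong (yes p) (yes q) _ _ = refl
⟦⟧-cong (yes p) (no ¬q) f _ = contradiction (f p) ¬q
⟦⟧-cong (no ¬p) (yes q) _ g = contradiction (g q) ¬p
⟦⟧-cong (no ¬p) (no ¬q) _ _ = refl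

⟦⟧-false : {P : Set} (P? : Dec P) → ¬ P → ⟦ P? ⟧ ≡ 0
⟦⟧-false (yes p) ¬p = contradiction p ¬p
⟦⟧-false (no _)  _  = refl

listSum-tabulate : ∀ {n} (g : Fin n → ℕ) → listSum (tabulate g) ≡ sum g
listSum-tabulate {zero}  g = refl
listSum-tabulate {suc n} g = cong (g zero +_) (listSum-tabulate (g ∘ suc))

listSum-allFin : ∀ n (g : Fin n → ℕ) → listSum (map g (allFin n)) ≡ sum g
listSum-allFin n g = trans (cong listSum (map-tabulate id g)) (listSum-tabulate g)

sum-++ : ∀ m {n} (g : Fin (m + n) → ℕ) →
         sum g ≡ sum (λ i → g (i ↑ˡ n)) + sum (λ j → g (m ↑ʳ j))
sum-++ zero    g = refl
sum-++ (suc m) g = trans (cong (g zero +_) (sum-++ m (g ∘ suc))) (sym (+-assoc (g zero) _ _))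

sum-combine : ∀ m {n} (g : Fin (m * n) → ℕ) →
              sum g ≡ ∑[ i < m ] ∑[ j < n ] g (combine i j)
sum-combine zero        g = refl
sum-combine (suc m) {n} g = trans (sum-++ n g) (cong (sum (λ i → g (i ↑ˡ (m * n))) +_) (sum-combine m (λ j → g (n ↑ʳ j))))

∑-*ˡ : ∀ {n} c (g : Fin n → ℕ) → ∑[ i < n ] (c * g i) ≡ c * sum g
∑-*ˡ c g = sym (*-distribˡ-sum c g)

sum-const : ∀ n c → ∑[ i < n ] c ≡ n * c
sum-const zero    c = refl
sum-const (suc n) c = cong (c +_) (sum-const n c)

sum-⟦≟⟧ : ∀ {n} (j : Fin n) (g : Fin n → ℕ) → ∑[ i < n ] (⟦ i ≟ j ⟧ * g i) ≡ g j
sum-⟦≟⟧ {suc n} zero g = begin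
  g zero + 0 + ∑[ i < n ] 0  ≡⟨ cong (g zero + 0 +_) (sum-replicate-zero n) ⟩
  g zero + 0 + 0             ≡⟨ +-identityʳ _ ⟩
  g zero + 0                 ≡⟨ +-identityʳ _ ⟩
  g zero                     ∎
sum-⟦≟⟧ {suc n} (suc j) g =
  trans (sum-cong-≗ (λ i → cong (_* g (suc i))
          (⟦⟧-cong (suc i ≟ suc j) (i ≟ j) suc-injective (cong suc))))
        (sum-⟦≟⟧ j (g ∘ suc))

-- Double counting: after exchanging the sums, `L k` is counted `sum (M k)` times, that is once. It
-- is applied with `k` an edge and `j` a vertex of one bipartition class.
sum-unitColumns : ∀ {m n} (M : Fin m → Fin n → ℕ) (L : Fin m → ℕ) →
                  (∀ k → sum (M k) ≡ 1) → ∑[ j < n ] ∑[ k < m ] (M k j * L k) ≡ sum L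
sum-unitColumns {m} {n} M L unit = begin
  ∑[ j < n ] ∑[ k < m ] (M k j * L k)  ≡⟨ ∑-comm (λ j k → M k j * L k) ⟩
  ∑[ k < m ] ∑[ j < n ] (M k j * L k)  ≡⟨ sum-cong-≗ (λ k → *-distribʳ-sum (L k) (M k)) ⟨
  ∑[ k < m ] (sum (M k) * L k)         ≡⟨ sum-cong-≗ (λ k → trans (cong (_* L k) (unit k)) (*-identityˡ (L k))) ⟩
  sum L                                ∎

-- Labels that are linear in `A` and `O` give vertex sums that are linear in them, with numerical
-- coefficients that can be evaluated.
sum-linear : ∀ {m} (M x y z : Fin m → ℕ) (A O : ℕ) →
             ∑[ k < m ] (M k * (x k * A + y k * O + z k)) ≡
             (∑[ k < m ] (M k * x k)) * A + (∑[ k < m ] (M k * y k)) * O + ∑[ k < m ] (M k * z k)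
sum-linear {m} M x y z A O = begin
  ∑[ k < m ] (M k * (x k * A + y k * O + z k))
    ≡⟨ sum-cong-≗ (λ k → expand (M k) (x k) (y k) (z k) A O) ⟩
  ∑[ k < m ] (M k * x k * A + M k * y k * O + M k * z k)
    ≡⟨ ∑-distrib-+ (λ k → M k * x k * A + M k * y k * O) (λ k → M k * z k) ⟩
  ∑[ k < m ] (M k * x k * A + M k * y k * O) + ∑[ k < m ] (M k * z k)
    ≡⟨ cong (_+ ∑[ k < m ] (M k * z k)) (∑-distrib-+ (λ k → M k * x k * A) (λ k → M k * y k * O)) ⟩
  ∑[ k < m ] (M k * x k * A) + ∑[ k < m ] (M k * y k * O) + ∑[ k < m ] (M k * z k)
    ≡⟨ cong₂ (λ u v → u + v + ∑[ k < m ] (M k * z k))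
         (*-distribʳ-sum A (λ k → M k * x k)) (*-distribʳ-sum O (λ k → M k * y k)) ⟨
  (∑[ k < m ] (M k * x k)) * A + (∑[ k < m ] (M k * y k)) * O + ∑[ k < m ] (M k * z k) ∎
  where
  expand : ∀ M x y z A O → M * (x * A + y * O + z) ≡ M * x * A + M * y * O + M * z
  expand = solve-∀

-- Counting with injections and duplicate-free lists.

injective⇒surjective : ∀ {n} (g : Fin n → Fin n) → Injective _≡_ _≡_ g → ∀ y → ∃ λ x → g x ≡ y
injective⇒surjective {suc n} g inj y with any? (λ x → g x ≟ y)
... | yes hit  = hit
-- Pigeonhole: punching out a missed value `y` would inject `Fin (suc n)` into `Fin n`.
... | no  miss = contradiction
  (injective⇒≤ {f = λ x → punchOut (y≢g x)} (λ {x} {x'} eq → inj (punchOut-injective (y≢g x) (y≢g x') eq)))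
  (n≮n n)
  where
  y≢g : ∀ x → y ≢ g x
  y≢g x y≡gx = miss (x , sym y≡gx)

injective⇒↔ : ∀ {n} (g : Fin n → Fin n) → Injective _≡_ _≡_ g → Fin n ↔ Fin n
injective⇒↔ g inj = mk↔ₛ′ g (proj₁ ∘ surj) (proj₂ ∘ surj) (λ x → inj (proj₂ (surj (g x))))
  where surj = injective⇒surjective g inj

-- Induction on `xs`, deleting one occurrence of its head from `ys`. It serves both bounds: three
-- distinct colours inside the deduplicated list, and the deduplicated list inside three values.
Unique⇒length≤ : {A : Set} {xs ys : List A} → Unique xs → (∀ {z} → z ∈ xs → z ∈ ys) →
                 length xs ≤ length ys
Unique⇒length≤ [] _ = z≤n
Unique⇒length≤ {xs = x ∷ xs} (x∉xs ∷ uniq) xs⊆ys with ∈-∃++ (xs⊆ys (here refl))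
... | as , bs , refl =
  subst (suc (length xs) ≤_) (sym (length-++-sucʳ as x bs)) (s≤s (Unique⇒length≤ uniq xs⊆as++bs))
  where
  xs⊆as++bs : ∀ {z} → z ∈ xs → z ∈ as ++ bs
  xs⊆as++bs z∈xs with ∈-++⁻ as (xs⊆ys (there z∈xs))
  ... | inj₁ z∈as           = ∈-++⁺ˡ z∈as
  ... | inj₂ (here refl)    = contradiction refl (All.lookup x∉xs z∈xs)
  ... | inj₂ (there z∈bs)   = ∈-++⁺ʳ as z∈bs

-- Colours of a labelling, and alternation along a path.

module _ (G : Graph) (f : Labeling G) where

  IsColour : ℕ → Set
  IsColour c = c ∈ map (vsum G f) (vertexList G)

  isColour-end : ∀ e {x} → x ∈ proj₁ (ends G e) ∷ proj₂ (ends G e) ∷ [] → IsColour (vsum G f x)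
  isColour-end e x∈ = ∈-map⁺ (vsum G f) (∈-concatMap⁺ _ (lose (∈-allFin e) x∈))

  colours<3⇒collapse : colours G f < 3 → ∀ {x y z} → IsColour x → IsColour y → IsColour z →
                       x ≢ y → y ≢ z → x ≡ z
  colours<3⇒collapse few {x} {y} {z} x∈ y∈ z∈ x≢y y≢z with x ℕ.≟ z
  ... | yes x≡z = x≡z
  ... | no  x≢z = contradiction few (≤⇒≯ (Unique⇒length≤ {xs = x ∷ y ∷ z ∷ []}
                    ((x≢y ∷ x≢z ∷ []) ∷ (y≢z ∷ []) ∷ [] ∷ []) λ
                    { (here refl)                 → ∈-deduplicate⁺ ℕ._≟_ x∈
                    ; (there (here refl))         → ∈-deduplicate⁺ ℕ._≟_ y∈
                    ; (there (there (here refl))) → ∈-deduplicate⁺ ℕ._≟_ z∈ }))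

  colours≤ : ∀ cs → (∀ e {x} → x ∈ proj₁ (ends G e) ∷ proj₂ (ends G e) ∷ [] → vsum G f x ∈ cs) →
             colours G f ≤ length cs
  colours≤ cs ends⊆cs = Unique⇒length≤ (deduplicate-! ℕ._≟_ _) (colours⊆cs ∘ ∈-deduplicate⁻ ℕ._≟_ _)
    where
    colours⊆cs : ∀ {c} → IsColour c → c ∈ cs
    colours⊆cs c∈ with ∈-map⁻ (vsum G f) c∈
    ... | x , x∈ , refl with find (∈-concatMap⁻ _ {allFin (m G)} x∈)
    ...   | e , _ , x∈e = ends⊆cs e x∈e

-- The values are read along the path x₀ y₀ x₁ y₁ ...: neighbours differ, and with two colours every
-- second value repeats.
alternating : ∀ {n} (P : ℕ → Set) →
              (∀ {x y z} → P x → P y → P z → x ≢ y → y ≢ z → x ≡ z) →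
              (x y : Fin (suc n) → ℕ) → (∀ i → P (x i)) → (∀ i → P (y i)) →
              (∀ i → x i ≢ y i) → (∀ i → y (inject₁ i) ≢ x (suc i)) →
              ∀ i → x i ≡ x zero × y i ≡ y zero
alternating P collapse x y Px Py x≢y y≢x zero = refl , refl
alternating {suc n} P collapse x y Px Py x≢y y≢x (suc i)
  with x≡ , y≡ ← alternating P collapse (x ∘ suc) (y ∘ suc) (Px ∘ suc) (Py ∘ suc) (x≢y ∘ suc) (y≢x ∘ suc) i
  -- The recursive call ends at index 1; the triples x₀ y₀ x₁ and y₀ x₁ y₁ lead back to index 0.
  = trans x≡ (sym (collapse (Px 0F) (Py 0F) (Px 1F) (x≢y 0F) (y≢x 0F)))
  , trans y≡ (sym (collapse (Py 0F) (Px 1F) (Py 1F) (y≢x 0F) (x≢y 1F)))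

-- A single copy of C₄(8,2).

Vertex : Set
Vertex = Fin 2 × Fin 8

_≟ᵥ_ : DecidableEquality Vertex
_≟ᵥ_ = ≡-dec _≟_ _≟_

-- The edge numbering of `mergedC48` with copy and merging forgotten, so that structural facts can
-- be decided by evaluation over 20 edges.
baseEnds : Fin 20 → Vertex × Vertex
baseEnds k with splitAt 8 {12} k
... | inj₁ i = (0F , i) , (0F , next8 i)
... | inj₂ k' with splitAt 8 {4} k'
...   | inj₁ i = (1F , i) , (1F , next8 i)
...   | inj₂ j = (0F , spokePos j) , (1F , spokePos j)

src tgt : Fin 20 → Vertex
src = proj₁ ∘ baseEnds
tgt = proj₂ ∘ baseEnds

multiplicity : Fin 20 → Vertex → ℕ
multiplicity k q = ⟦ src k ≟ᵥ q ⟧ + ⟦ tgt k ≟ᵥ q ⟧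

copySum : (Fin 20 → ℕ) → Vertex → ℕ
copySum L q = ∑[ k < 20 ] (multiplicity k q * L k)

-- evens and odds alternate along the Hamiltonian path u₀ u₁ … u₇ v₇ v₀ … v₆ and form the bipartition of C₄(8,2).
evens odds : Fin 8 → Vertex
evens = lookup ((0F , 0F) ∷ (0F , 2F) ∷ (0F , 4F) ∷ (0F , 6F) ∷ (1F , 7F) ∷ (1F , 1F) ∷ (1F , 3F) ∷ (1F , 5F) ∷ [])
odds  = lookup ((0F , 1F) ∷ (0F , 3F) ∷ (0F , 5F) ∷ (0F , 7F) ∷ (1F , 0F) ∷ (1F , 2F) ∷ (1F , 4F) ∷ (1F , 6F) ∷ [])

-- The path edges, read off the edge numbering. All of them are stored in the direction of the path,
-- so their end pairs need no swapping. Edge 19 is the spoke from u₇ to v₇.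
evenOddEdge : Fin 8 → Fin 20
evenOddEdge = lookup (# 0 ∷ # 2 ∷ # 4 ∷ # 6 ∷ # 15 ∷ # 9 ∷ # 11 ∷ # 13 ∷ [])

oddEvenEdge : Fin 7 → Fin 20
oddEvenEdge = lookup (# 1 ∷ # 3 ∷ # 5 ∷ # 19 ∷ # 8 ∷ # 10 ∷ # 12 ∷ [])

baseEnds-evenOddEdge : ∀ i → baseEnds (evenOddEdge i) ≡ (evens i , odds i)
baseEnds-evenOddEdge = from-yes (all? λ i → ≡-dec _≟ᵥ_ _≟ᵥ_ (baseEnds (evenOddEdge i)) (evens i , odds i))

baseEnds-oddEvenEdge : ∀ i → baseEnds (oddEvenEdge i) ≡ (odds (inject₁ i) , evens (suc i))
baseEnds-oddEvenEdge = from-yes (all? λ i → ≡-dec _≟ᵥ_ _≟ᵥ_ (baseEnds (oddEvenEdge i)) (odds (inject₁ i) , evens (suc i)))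

one-even-end : ∀ k → ∑[ j < 8 ] multiplicity k (evens j) ≡ 1
one-even-end = from-yes (all? λ k → (∑[ j < 8 ] multiplicity k (evens j)) ℕ.≟ 1)

one-odd-end : ∀ k → ∑[ j < 8 ] multiplicity k (odds j) ≡ 1
one-odd-end = from-yes (all? λ k → (∑[ j < 8 ] multiplicity k (odds j)) ℕ.≟ 1)

-- Vertex sums in the merged graph.

module _ (r s : ℕ) (merge : Fin 2 → Fin 8 → Bool) where

  private
    G = mergedC48 r s merge

  home : Fin (r * s) → Vertex → Fin (r * s) ⊎ Fin r
  home a (sd , i) = if merge sd i then inj₂ (proj₁ (remQuot {r} s a)) else inj₁ a

  vertex : Fin (r * s) → Vertex → MVert r s
  vertex a q = home a q , q

  copyEnds : Fin (r * s) × Fin 20 → MVert r s × MVert r s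
  copyEnds (a , k) = vertex a (src k) , vertex a (tgt k)

  ends-remQuot : ∀ e → ends G e ≡ copyEnds (remQuot 20 e)
  -- `remQuot` swaps the pair returned by `quotRem`. The splits below repeat those in the definition
  -- of the graph until both sides compute.
  ends-remQuot e with quotRem {r * s} 20 e
  ... | k , a with splitAt 8 {12} k
  ...   | inj₁ i with merge 0F i | merge 0F (next8 i)
  ...     | true  | true  = refl
  ...     | true  | false = refl
  ...     | false | true  = refl
  ...     | false | false = refl
  ends-remQuot e | k , a | inj₂ k' with splitAt 8 {4} k'
  ...   | inj₁ i with merge 1F i | merge 1F (next8 i)
  ...     | true  | true  = refl
  ...     | true  | false = refl
  ...     | false | true  = refl
  ...     | false | false = refl
  ends-remQuot e | k , a | inj₂ k' | inj₂ j with merge 0F (spokePos j) | merge 1F (spokePos j)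
  ...     | true  | true  = refl
  ...     | true  | false = refl
  ...     | false | true  = refl
  ...     | false | false = refl

  ends-combine : ∀ a k → ends G (combine a k) ≡ (vertex a (src k) , vertex a (tgt k))
  ends-combine a k = trans (ends-remQuot (combine a k)) (cong copyEnds (remQuot-combine a k))

  _≟ₕ_ : DecidableEquality (Fin (r * s) ⊎ Fin r)
  _≟ₕ_ = ⊎-≡-dec _≟_ _≟_

  -- The first factor uses `home a q` instead of `home a p`: they agree when `p ≡ q`, and otherwise
  -- the second factor is 0. It is thus common to both ends of an edge and can be factored out.
  ⟦vertex≟⟧ : ∀ a p c q → ⟦ MVert-≟ r s (vertex a p) (c , q) ⟧ ≡ ⟦ home a q ≟ₕ c ⟧ * ⟦ p ≟ᵥ q ⟧
  ⟦vertex≟⟧ a p c q with p ≟ᵥ q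
  ... | yes refl = trans (⟦⟧-cong (MVert-≟ r s _ _) (home a q ≟ₕ c) ,-injectiveˡ (cong (_, q)))
                         (sym (*-identityʳ _))
  ... | no p≢q   = trans (⟦⟧-false (MVert-≟ r s _ _) (p≢q ∘ cong proj₂)) (sym (*-zeroʳ ⟦ home a q ≟ₕ c ⟧))

  incidence-combine : ∀ a k c q →
                      incidence G (combine a k) (c , q) ≡ ⟦ home a q ≟ₕ c ⟧ * multiplicity k q
  incidence-combine a k c q = begin
    incidence G (combine a k) (c , q)
      ≡⟨ cong (λ e → ⟦ MVert-≟ r s (proj₁ e) (c , q) ⟧ + ⟦ MVert-≟ r s (proj₂ e) (c , q) ⟧) (ends-combine a k) ⟩
    ⟦ MVert-≟ r s (vertex a (src k)) (c , q) ⟧ + ⟦ MVert-≟ r s (vertex a (tgt k)) (c , q) ⟧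
      ≡⟨ cong₂ _+_ (⟦vertex≟⟧ a (src k) c q) (⟦vertex≟⟧ a (tgt k) c q) ⟩
    ⟦ home a q ≟ₕ c ⟧ * ⟦ src k ≟ᵥ q ⟧ + ⟦ home a q ≟ₕ c ⟧ * ⟦ tgt k ≟ᵥ q ⟧
      ≡⟨ *-distribˡ-+ ⟦ home a q ≟ₕ c ⟧ ⟦ src k ≟ᵥ q ⟧ ⟦ tgt k ≟ᵥ q ⟧ ⟨
    ⟦ home a q ≟ₕ c ⟧ * multiplicity k q ∎

  labels : Labeling G → Fin (r * s) → Fin 20 → ℕ
  labels f a k = label G f (combine a k)

  vsum-copies : ∀ f c q →
                vsum G f (c , q) ≡ ∑[ a < r * s ] (⟦ home a q ≟ₕ c ⟧ * copySum (labels f a) q)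
  vsum-copies f c q = begin
    vsum G f (c , q)
      ≡⟨ listSum-allFin (m G) _ ⟩
    ∑[ e < r * s * 20 ] (incidence G e (c , q) * label G f e)
      ≡⟨ sum-combine (r * s) _ ⟩
    ∑[ a < r * s ] ∑[ k < 20 ] (incidence G (combine a k) (c , q) * labels f a k)
      ≡⟨ sum-cong-≗ (λ a → begin
           ∑[ k < 20 ] (incidence G (combine a k) (c , q) * labels f a k)
             ≡⟨ sum-cong-≗ {20} (λ k → trans (cong (_* labels f a k) (incidence-combine a k c q))
                                        (*-assoc ⟦ home a q ≟ₕ c ⟧ (multiplicity k q) (labels f a k))) ⟩
           ∑[ k < 20 ] (⟦ home a q ≟ₕ c ⟧ * (multiplicity k q * labels f a k))
             ≡⟨ ∑-*ˡ ⟦ home a q ≟ₕ c ⟧ (λ k → multiplicity k q * labels f a k) ⟩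
           ⟦ home a q ≟ₕ c ⟧ * copySum (labels f a) q ∎) ⟩
    ∑[ a < r * s ] (⟦ home a q ≟ₕ c ⟧ * copySum (labels f a) q) ∎

  isMerged : Vertex → Bool
  isMerged = uncurry merge

  blockSum : (Fin (r * s) → Fin 20 → ℕ) → Fin r → Vertex → ℕ
  blockSum L b q = ∑[ i < s ] copySum (L (combine b i)) q

  vsum-unmerged : ∀ f a q → isMerged q ≡ false → vsum G f (vertex a q) ≡ copySum (labels f a) q
  vsum-unmerged f a q eq = begin
    vsum G f (vertex a q)
      ≡⟨ vsum-copies f (home a q) q ⟩
    ∑[ a' < r * s ] (⟦ home a' q ≟ₕ home a q ⟧ * copySum (labels f a') q)
      ≡⟨ sum-cong-≗ (λ a' → cong (_* copySum (labels f a') q) (sameCopy a')) ⟩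
    ∑[ a' < r * s ] (⟦ a' ≟ a ⟧ * copySum (labels f a') q)
      ≡⟨ sum-⟦≟⟧ a (λ a' → copySum (labels f a') q) ⟩
    copySum (labels f a) q ∎
    where
    home-unmerged : ∀ a' → home a' q ≡ inj₁ a'
    home-unmerged a' rewrite eq = refl
    sameCopy : ∀ a' → ⟦ home a' q ≟ₕ home a q ⟧ ≡ ⟦ a' ≟ a ⟧
    sameCopy a' rewrite home-unmerged a' | home-unmerged a =
      ⟦⟧-cong (inj₁ a' ≟ₕ inj₁ a) (a' ≟ a) inj₁-injective (cong inj₁)

  home-merged : ∀ {q} → isMerged q ≡ true → ∀ b i → home (combine b i) q ≡ inj₂ b
  home-merged eq b i rewrite eq = cong (inj₂ ∘ proj₁) (remQuot-combine b i)

  vsum-merged : ∀ f b i q → isMerged q ≡ true →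
                vsum G f (vertex (combine b i) q) ≡ blockSum (labels f) b q
  vsum-merged f b i q eq = begin
    vsum G f (vertex (combine b i) q)
      ≡⟨ vsum-copies f (home (combine b i) q) q ⟩
    ∑[ a < r * s ] (⟦ home a q ≟ₕ home (combine b i) q ⟧ * copySum (labels f a) q)
      ≡⟨ sum-combine r _ ⟩
    ∑[ b' < r ] ∑[ i' < s ] (⟦ home (combine b' i') q ≟ₕ home (combine b i) q ⟧ * copySum (labels f (combine b' i')) q)
      ≡⟨ sum-cong-≗ (λ b' → trans
           (sum-cong-≗ {s} (λ i' → cong (_* copySum (labels f (combine b' i')) q) (sameBlock b' i')))
           (∑-*ˡ ⟦ b' ≟ b ⟧ (λ i' → copySum (labels f (combine b' i')) q))) ⟩
    ∑[ b' < r ] (⟦ b' ≟ b ⟧ * blockSum (labels f) b' q)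
      ≡⟨ sum-⟦≟⟧ b (λ b' → blockSum (labels f) b' q) ⟩
    blockSum (labels f) b q ∎
    where
    sameBlock : ∀ b' i' → ⟦ home (combine b' i') q ≟ₕ home (combine b i) q ⟧ ≡ ⟦ b' ≟ b ⟧
    sameBlock b' i' rewrite home-merged eq b' i' | home-merged eq b i =
      ⟦⟧-cong (inj₂ b' ≟ₕ inj₂ b) (b' ≟ b) inj₂-injective (cong inj₂)

  -- The number of vertices that a block of `s` copies has at position `q`.
  weight : Vertex → ℕ
  weight q = if isMerged q then 1 else s

  blockSum-const : ∀ f b q c → Fin s → (∀ i → vsum G f (vertex (combine b i) q) ≡ c) →
                   blockSum (labels f) b q ≡ weight q * c
  -- Any copy represents the merged vertex; `i₀` supplies one.
  blockSum-const f b q c i₀ const = cases (isMerged q) refl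
    where
    cases : ∀ merged → isMerged q ≡ merged → blockSum (labels f) b q ≡ (if merged then 1 else s) * c
    cases true  eq = trans (sym (vsum-merged f b i₀ q eq)) (trans (const i₀) (sym (*-identityˡ c)))
    cases false eq = begin
      ∑[ i < s ] copySum (labels f (combine b i)) q
        ≡⟨ sum-cong-≗ (λ i → trans (sym (vsum-unmerged f (combine b i) q eq)) (const i)) ⟩
      ∑[ i < s ] c
        ≡⟨ sum-const s c ⟩
      s * c ∎

  -- Each edge of the block has exactly one end in the class `side`, so its label is counted once.
  ∑-blockSum : ∀ L b (side : Fin 8 → Vertex) → (∀ k → ∑[ j < 8 ] multiplicity k (side j) ≡ 1) →
               ∑[ j < 8 ] blockSum L b (side j) ≡ ∑[ i < s ] sum (L (combine b i))
  ∑-blockSum L b side one = begin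
    ∑[ j < 8 ] ∑[ i < s ] copySum (L (combine b i)) (side j)
      ≡⟨ ∑-comm (λ j i → copySum (L (combine b i)) (side j)) ⟩
    ∑[ i < s ] ∑[ j < 8 ] copySum (L (combine b i)) (side j)
      ≡⟨ sum-cong-≗ (λ i → sum-unitColumns (λ k j → multiplicity k (side j)) (L (combine b i)) one) ⟩
    ∑[ i < s ] sum (L (combine b i)) ∎

  -- The lower bound.

  -- `N` is the common number of vertices of the two classes in a block. A merged vertex in each
  -- class makes all copies of the block use the same two colours on the same classes.
  colours≥3 : ∀ N .{{_ : NonZero N}} →
              (∃ λ j → isMerged (evens j) ≡ true) → ∑[ j < 8 ] weight (evens j) ≡ N →
              (∃ λ j → isMerged (odds j) ≡ true) → ∑[ j < 8 ] weight (odds j) ≡ N →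
              Fin r → Fin s → ∀ f → LocalAntimagic G f → 3 ≤ colours G f
  colours≥3 N (je , mergedE) sizeE (jo , mergedO) sizeO b i₀ f antimagic =
    ≮⇒≥ (λ few → antimagic⇒≢ few (*-cancelˡ-≡ _ _ N (equal few)))
    where
    F : Fin s → Vertex → ℕ
    F i q = vsum G f (vertex (combine b i) q)

    α β : ℕ
    α = vsum G f (inj₂ b , evens je)
    β = vsum G f (inj₂ b , odds jo)

    isColour : ∀ i k {q} → q ∈ src k ∷ tgt k ∷ [] → IsColour G f (F i q)
    isColour i k {q} q∈ = isColour-end G f (combine (combine b i) k)
      (subst (λ e → vertex (combine b i) q ∈ proj₁ e ∷ proj₂ e ∷ [])
             (sym (ends-combine (combine b i) k)) (∈-map⁺ (vertex (combine b i)) q∈))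

    F-src≢tgt : ∀ i k → F i (src k) ≢ F i (tgt k)
    F-src≢tgt i k = subst (λ e → vsum G f (proj₁ e) ≢ vsum G f (proj₂ e))
                          (ends-combine (combine b i) k) (antimagic (combine (combine b i) k))

    F≢ : ∀ i k {p q} → baseEnds k ≡ (p , q) → F i p ≢ F i q
    F≢ i k refl = F-src≢tgt i k

    isColourˡ : ∀ i k {p q} → baseEnds k ≡ (p , q) → IsColour G f (F i p)
    isColourˡ i k refl = isColour i k (here refl)

    isColourʳ : ∀ i k {p q} → baseEnds k ≡ (p , q) → IsColour G f (F i q)
    isColourʳ i k refl = isColour i k (there (here refl))

    module _ (few : colours G f < 3) where

      alternate : ∀ i j → F i (evens j) ≡ F i (evens 0F) × F i (odds j) ≡ F i (odds 0F)
      alternate i = alternating (IsColour G f) (colours<3⇒collapse G f few)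
        (F i ∘ evens) (F i ∘ odds)
        (λ j → isColourˡ i (evenOddEdge j) (baseEnds-evenOddEdge j))
        (λ j → isColourʳ i (evenOddEdge j) (baseEnds-evenOddEdge j))
        (λ j → F≢ i (evenOddEdge j) (baseEnds-evenOddEdge j))
        (λ j → F≢ i (oddEvenEdge j) (baseEnds-oddEvenEdge j))

      F-even : ∀ j i → F i (evens j) ≡ α
      -- Inside copy `i` the colour is carried along the path to `evens je`, which is the merged
      -- vertex shared by the whole block.
      F-even j i = trans (proj₁ (alternate i j)) (trans (sym (proj₁ (alternate i je)))
        (cong (λ c → vsum G f (c , evens je)) (home-merged mergedE b i)))

      F-odd : ∀ j i → F i (odds j) ≡ β
      F-odd j i = trans (proj₂ (alternate i j)) (trans (sym (proj₂ (alternate i jo)))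
        (cong (λ c → vsum G f (c , odds jo)) (home-merged mergedO b i)))

      antimagic⇒≢ : α ≢ β
      antimagic⇒≢ α≡β = F≢ i₀ (evenOddEdge 0F) (baseEnds-evenOddEdge 0F)
        (trans (F-even 0F i₀) (trans α≡β (sym (F-odd 0F i₀))))

      ∑-side : ∀ (side : Fin 8 → Vertex) c → ∑[ j < 8 ] weight (side j) ≡ N →
               (∀ j i → F i (side j) ≡ c) → ∑[ j < 8 ] blockSum (labels f) b (side j) ≡ N * c
      ∑-side side c size const = begin
        ∑[ j < 8 ] blockSum (labels f) b (side j)
          ≡⟨ sum-cong-≗ (λ j → blockSum-const f b (side j) c i₀ (const j)) ⟩
        ∑[ j < 8 ] (weight (side j) * c)
          ≡⟨ *-distribʳ-sum c (weight ∘ side) ⟨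
        (∑[ j < 8 ] weight (side j)) * c
          ≡⟨ cong (_* c) size ⟩
        N * c ∎

      equal : N * α ≡ N * β
      equal = begin
        N * α                                       ≡⟨ ∑-side evens α sizeE F-even ⟨
        ∑[ j < 8 ] blockSum (labels f) b (evens j)  ≡⟨ ∑-blockSum (labels f) b evens one-even-end ⟩
        ∑[ i < s ] sum (labels f (combine b i))     ≡⟨ ∑-blockSum (labels f) b odds one-odd-end ⟨
        ∑[ j < 8 ] blockSum (labels f) b (odds j)   ≡⟨ ∑-side odds β sizeO F-odd ⟩
        N * β                                       ∎

-- The labelling and its bijectivity.

-- code k = (ρ , ε , up): with x = a if up and x = n − 1 − a otherwise, edge k of copy a gets the label
-- 10 Q + ρ + 1 where Q = ε n + x on the cycles and Q = 2 x + ε on the spokes (ρ = 3, 6).  At a degree-3 vertex the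
-- two cycle edges have coefficients of a of the same sign, which the spoke has to cancel with twice the slope.
code : Fin 20 → Fin 10 × Fin 2 × Bool
code = lookup
  ( (7F , 1F , false) ∷ (8F , 0F , false) ∷ (1F , 1F , true) ∷ (5F , 0F , true)
  ∷ (4F , 1F , false) ∷ (9F , 0F , false) ∷ (0F , 1F , true) ∷ (2F , 0F , true)
  ∷ (7F , 0F , false) ∷ (9F , 1F , false) ∷ (0F , 0F , true) ∷ (5F , 1F , true)
  ∷ (4F , 0F , false) ∷ (8F , 1F , false) ∷ (1F , 0F , true) ∷ (2F , 1F , true)
  ∷ (3F , 0F , true)  ∷ (3F , 1F , false) ∷ (6F , 0F , true) ∷ (6F , 1F , false)
  ∷ [])

residue : Fin 20 → Fin 10
residue = proj₁ ∘ code

half : Fin 20 → Fin 2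
half = proj₁ ∘ proj₂ ∘ code

ascending : Fin 20 → Bool
ascending = proj₂ ∘ proj₂ ∘ code

-- The inverse table of `code`: each pair (ρ, ε) belongs to one edge, so the direction need not be
-- given.
decode : Fin 10 → Fin 2 → Fin 20
decode ρ ε = lookup (lookup
  ( (# 10 ∷ # 6 ∷ []) ∷ (# 14 ∷ # 2 ∷ []) ∷ (# 7 ∷ # 15 ∷ []) ∷ (# 16 ∷ # 17 ∷ []) ∷ (# 12 ∷ # 4 ∷ [])
  ∷ (# 3 ∷ # 11 ∷ []) ∷ (# 18 ∷ # 19 ∷ []) ∷ (# 8 ∷ # 0 ∷ []) ∷ (# 1 ∷ # 13 ∷ []) ∷ (# 5 ∷ # 9 ∷ []) ∷ []) ρ) ε

decode-code : ∀ k → decode (residue k) (half k) ≡ k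
decode-code = from-yes (all? λ k → decode (residue k) (half k) ≟ k)

-- The residues of the spokes, whose two halves are interleaved to double the slope.
paired : Fin 10 → Bool
paired 3F = true
paired 6F = true
paired _  = false

orient : ∀ {n} → Bool → Fin n → Fin n
orient true  a = a
orient false a = opposite a

slot : ∀ {n} → Bool → Fin 2 → Fin n → Fin (n * 2)
slot     true  ε x = combine x ε
slot {n} false ε x = cast (*-comm 2 n) (combine ε x)

place : ∀ {n} → Fin n → Fin 20 → Fin (n * 20)
place {n} a k =
  cast (*-assoc n 2 10) (combine (slot (paired (residue k)) (half k) (orient (ascending k) a)) (residue k))

cast-injective : ∀ {m n} .(eq : m ≡ n) {i j : Fin m} → cast eq i ≡ cast eq j → i ≡ j
cast-injective eq {i} {j} ci≡cj =
  toℕ-injective (trans (sym (toℕ-cast eq i)) (trans (cong toℕ ci≡cj) (toℕ-cast eq j)))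

orient-injective : ∀ {n} up {a a' : Fin n} → orient up a ≡ orient up a' → a ≡ a'
orient-injective true  eq = eq
orient-injective false {a} {a'} eq =
  trans (sym (opposite-involutive a)) (trans (cong opposite eq) (opposite-involutive a'))

slot-injective : ∀ {n} il {ε ε'} {x x' : Fin n} → slot il ε x ≡ slot il ε' x' → ε ≡ ε' × x ≡ x'
slot-injective true  {ε} {ε'} {x} {x'} eq with combine-injective x ε x' ε' eq
... | x≡x' , ε≡ε' = ε≡ε' , x≡x'
slot-injective {n} false {ε} {ε'} {x} {x'} eq = combine-injective ε x ε' x' (cast-injective (*-comm 2 n) eq)

-- The label is decoded in stages: the remainder mod 10 gives ρ and hence the kind of slot, the slot
-- gives ε and x, (ρ, ε) gives the edge, and its direction turns x into the copy.
place-injective : ∀ {n} (a : Fin n) k a' k' → place a k ≡ place a' k' → (a , k) ≡ (a' , k')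
place-injective {n} a k a' k' eq = sameEdge k≡k' slot≡
  where
  slots = combine-injective
    (slot (paired (residue k)) (half k) (orient (ascending k) a)) (residue k)
    (slot (paired (residue k')) (half k') (orient (ascending k') a')) (residue k')
    (cast-injective (*-assoc n 2 10) eq)
  slot≡ : slot (paired (residue k')) (half k) (orient (ascending k) a) ≡
          slot (paired (residue k')) (half k') (orient (ascending k') a')
  slot≡ = subst (λ ρ → slot (paired ρ) (half k) (orient (ascending k) a) ≡
                       slot (paired (residue k')) (half k') (orient (ascending k') a'))
                (proj₂ slots) (proj₁ slots)
  k≡k' : k ≡ k'
  k≡k' = trans (sym (decode-code k)) (trans
    (cong₂ decode (proj₂ slots) (proj₁ (slot-injective (paired (residue k')) slot≡)))
    (decode-code k'))
  -- Generalising `k` to `l` lets the equation be matched, after which both slots use the same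
  -- direction.
  sameEdge : ∀ {l} → l ≡ k' → slot (paired (residue k')) (half l) (orient (ascending l) a) ≡
                              slot (paired (residue k')) (half k') (orient (ascending k') a') →
             (a , l) ≡ (a' , k')
  sameEdge refl eq' = cong (_, k')
    (orient-injective (ascending k') (proj₂ (slot-injective (paired (residue k')) eq')))

placeIndex : ∀ n → Fin (n * 20) → Fin (n * 20)
placeIndex n e = uncurry place (remQuot {n} 20 e)

placeIndex-injective : ∀ n → Injective _≡_ _≡_ (placeIndex n)
placeIndex-injective n {e} {e'} eq = begin
  e                                  ≡⟨ combine-remQuot {n} 20 e ⟨
  uncurry combine (remQuot {n} 20 e)   ≡⟨ cong (uncurry combine) (place-injective (proj₁ aₖ) (proj₂ aₖ) (proj₁ aₖ') (proj₂ aₖ') eq) ⟩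
  uncurry combine (remQuot {n} 20 e')  ≡⟨ combine-remQuot {n} 20 e' ⟩
  e'                                 ∎
  where
  aₖ  = remQuot {n} 20 e
  aₖ' = remQuot {n} 20 e'

labelling : ∀ n → Fin (n * 20) ↔ Fin (n * 20)
labelling n = injective⇒↔ (placeIndex n) (placeIndex-injective n)

labelling-combine : ∀ {n} (a : Fin n) k → Inverse.to (labelling n) (combine a k) ≡ place a k
labelling-combine a k = cong (uncurry place) (remQuot-combine a k)

-- Labels as linear forms, and the vertex sums in one copy.

-- Coefficients of a label in A = a and O = n - 1 - a. On the cycles 10 ε n becomes 10 ε (A + 1 +
-- O), giving `shift` in both slopes and 10 ε in `intercept`; on the spokes that 10 ε is the
-- interleaving bit.
shift stride upSlope downSlope intercept : Fin 20 → ℕ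
shift     k = if paired (residue k) then 0 else 10 * toℕ (half k)
stride    k = if paired (residue k) then 20 else 10
upSlope   k = shift k + (if ascending k then stride k else 0)
downSlope k = shift k + (if ascending k then 0 else stride k)
intercept k = suc (10 * toℕ (half k) + toℕ (residue k))

size-split : ∀ {n} (a : Fin n) → n ≡ toℕ a + suc (toℕ (opposite a))
size-split {n} a = sym (begin
  toℕ a + suc (toℕ (opposite a))    ≡⟨ +-suc (toℕ a) _ ⟩
  suc (toℕ a) + toℕ (opposite a)    ≡⟨ cong (suc (toℕ a) +_) (opposite-prop a) ⟩
  suc (toℕ a) + (n ∸ suc (toℕ a))  ≡⟨ m+[n∸m]≡n (toℕ<n a) ⟩
  n                                 ∎)

toℕ-place : ∀ {n} (a : Fin n) k →
            suc (toℕ (place a k)) ≡ upSlope k * toℕ a + downSlope k * toℕ (opposite a) + intercept k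
toℕ-place {n} a k = begin
  suc (toℕ (place a k))
    ≡⟨ cong suc (trans (toℕ-cast (*-assoc n 2 10) (combine σ (residue k))) (toℕ-combine σ (residue k))) ⟩
  suc (10 * toℕ σ + ρ)
    ≡⟨ cases (paired (residue k)) (ascending k) ⟩
  upSlope k * A + downSlope k * O + intercept k ∎
  where
  A = toℕ a
  O = toℕ (opposite a)
  ε = toℕ (half k)
  ρ = toℕ (residue k)
  σ = slot (paired (residue k)) (half k) (orient (ascending k) a)
  split : ∀ x → suc (10 * toℕ (slot {n} false (half k) x) + ρ) ≡ suc (10 * ((A + suc O) * ε + toℕ x) + ρ)
  split x = cong (λ t → suc (10 * t + ρ)) (trans (toℕ-cast (*-comm 2 n) (combine (half k) x))
              (trans (toℕ-combine (half k) x) (cong (λ t → t * ε + toℕ x) (size-split a))))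
  interleave : ∀ x → suc (10 * toℕ (slot {n} true (half k) x) + ρ) ≡ suc (10 * (2 * toℕ x + ε) + ρ)
  interleave x = cong (λ t → suc (10 * t + ρ)) (toℕ-combine x (half k))
  cases : ∀ il up → suc (10 * toℕ (slot il (half k) (orient up a)) + ρ) ≡
          ((if il then 0 else 10 * ε) + (if up then (if il then 20 else 10) else 0)) * A +
          ((if il then 0 else 10 * ε) + (if up then 0 else (if il then 20 else 10))) * O +
          suc (10 * ε + ρ)
  cases true  true  = trans (interleave a) (eq A O ε ρ)
    where eq : ∀ A O ε ρ → suc (10 * (2 * A + ε) + ρ) ≡ 20 * A + 0 * O + suc (10 * ε + ρ)
          eq = solve-∀
  cases true  false = trans (interleave (opposite a)) (eq A O ε ρ)
    where eq : ∀ A O ε ρ → suc (10 * (2 * O + ε) + ρ) ≡ 0 * A + 20 * O + suc (10 * ε + ρ)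
          eq = solve-∀
  cases false true  = trans (split a) (eq A O ε ρ)
    where eq : ∀ A O ε ρ → suc (10 * ((A + suc O) * ε + A) + ρ) ≡
                           (10 * ε + 10) * A + (10 * ε + 0) * O + suc (10 * ε + ρ)
          eq = solve-∀
  cases false false = trans (split (opposite a)) (eq A O ε ρ)
    where eq : ∀ A O ε ρ → suc (10 * ((A + suc O) * ε + O) + ρ) ≡
                           (10 * ε + 0) * A + (10 * ε + 10) * O + suc (10 * ε + ρ)
          eq = solve-∀

-- Class 0 consists of the degree-2 vertices, merged in G₁; class 1 of the degree-3 vertices merged
-- in G₂; class 2 of their neighbours along the spokes.
class : Vertex → Fin 3
class (sd , i) = lookup (lookup
  ( (0F ∷ 1F ∷ 0F ∷ 2F ∷ 0F ∷ 2F ∷ 0F ∷ 1F ∷ [])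
  ∷ (0F ∷ 2F ∷ 0F ∷ 1F ∷ 0F ∷ 1F ∷ 0F ∷ 2F ∷ [])
  ∷ []) sd) i

slope offset : Fin 3 → ℕ
slope  = lookup (20 ∷ 30 ∷ 30 ∷ [])
offset = lookup (1 ∷ 1 ∷ 2 ∷ [])

coefficients : Vertex → ℕ × ℕ × ℕ
coefficients q = ∑[ k < 20 ] (multiplicity k q * upSlope k)
               , ∑[ k < 20 ] (multiplicity k q * downSlope k)
               , ∑[ k < 20 ] (multiplicity k q * intercept k)

-- Equal coefficients of A and O make the sum independent of the copy; the extra slope in the
-- constant comes from the 1 in n = A + 1 + O.
coefficients-class : ∀ sd i → let t = class (sd , i) in
                     coefficients (sd , i) ≡ (slope t , slope t , slope t + offset t)
coefficients-class = from-yes (all? λ sd → all? λ i → let t = class (sd , i) in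
  ≡-dec ℕ._≟_ (≡-dec ℕ._≟_ ℕ._≟_) (coefficients (sd , i)) (slope t , slope t , slope t + offset t))

class-proper : ∀ k → class (src k) ≢ class (tgt k)
class-proper = from-yes (all? λ k → ¬? (class (src k) ≟ class (tgt k)))

-- The label-weighted degree: the sum that one copy contributes at a vertex of class `t`.
degree : ℕ → Fin 3 → ℕ
degree n t = slope t * n + offset t

copySum-labelling : ∀ {n} (a : Fin n) q →
  copySum (λ k → suc (toℕ (Inverse.to (labelling n) (combine a k)))) q ≡ degree n (class q)
copySum-labelling {n} a q@(sd , i) = begin
  copySum (λ k → suc (toℕ (Inverse.to (labelling n) (combine a k)))) q
    ≡⟨ sum-cong-≗ (λ k → cong (multiplicity k q *_)
         (trans (cong (suc ∘ toℕ) (labelling-combine a k)) (toℕ-place a k))) ⟩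
  ∑[ k < 20 ] (multiplicity k q * (upSlope k * A + downSlope k * O + intercept k))
    ≡⟨ sum-linear (λ k → multiplicity k q) upSlope downSlope intercept A O ⟩
  (∑[ k < 20 ] (multiplicity k q * upSlope k)) * A + (∑[ k < 20 ] (multiplicity k q * downSlope k)) * O +
    ∑[ k < 20 ] (multiplicity k q * intercept k)
    ≡⟨ cong (λ (x , y , z) → x * A + y * O + z) (coefficients-class sd i) ⟩
  slope (class q) * A + slope (class q) * O + (slope (class q) + offset (class q))
    ≡⟨ collect (slope (class q)) A O (offset (class q)) ⟩
  degree (A + suc O) (class q)
    ≡⟨ cong (λ m → degree m (class q)) (size-split a) ⟨
  degree n (class q) ∎
  where
  A = toℕ a
  O = toℕ (opposite a)
  collect : ∀ m A O c → m * A + m * O + (m + c) ≡ m * (A + suc O) + c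
  collect = solve-∀

-- Three colours suffice when exactly one class is merged.

module _ (r s : ℕ) (merge : Fin 2 → Fin 8 → Bool) (merged : Fin 3)
         (merge-class : ∀ sd i → merge sd i ≡ ⌊ class (sd , i) ≟ merged ⌋) where

  private
    G = mergedC48 r s merge

  mergedDegree : Fin 3 → ℕ
  mergedDegree t = if ⌊ t ≟ merged ⌋ then s * degree (r * s) t else degree (r * s) t

  vsum-labelling : ∀ b i q → vsum G (labelling (r * s)) (vertex r s merge (combine b i) q) ≡ mergedDegree (class q)
  vsum-labelling b i q@(sd , j) with ⌊ class q ≟ merged ⌋ | merge-class sd j
  ... | true  | eq = begin
    vsum G (labelling (r * s)) (vertex r s merge (combine b i) q)
      ≡⟨ vsum-merged r s merge (labelling (r * s)) b i q eq ⟩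
    ∑[ i' < s ] copySum (labels r s merge (labelling (r * s)) (combine b i')) q
      ≡⟨ sum-cong-≗ {s} (λ i' → copySum-labelling (combine b i') q) ⟩
    ∑[ i' < s ] degree (r * s) (class q)
      ≡⟨ sum-const s (degree (r * s) (class q)) ⟩
    s * degree (r * s) (class q) ∎
  ... | false | eq = trans (vsum-unmerged r s merge (labelling (r * s)) (combine b i) q eq)
                           (copySum-labelling (combine b i) q)

  vsum-labelling-ends : ∀ e → ∃ λ k →
    vsum G (labelling (r * s)) (proj₁ (ends G e)) ≡ mergedDegree (class (src k)) ×
    vsum G (labelling (r * s)) (proj₂ (ends G e)) ≡ mergedDegree (class (tgt k))
  vsum-labelling-ends e = k
    , trans (cong (vsum G (labelling (r * s)) ∘ proj₁) ends≡) (vsum-labelling b i (src k))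
    , trans (cong (vsum G (labelling (r * s)) ∘ proj₂) ends≡) (vsum-labelling b i (tgt k))
    where
    a = proj₁ (remQuot {r * s} 20 e)
    k = proj₂ (remQuot {r * s} 20 e)
    b = proj₁ (remQuot {r} s a)
    i = proj₂ (remQuot {r} s a)
    ends≡ : ends G e ≡ (vertex r s merge (combine b i) (src k) , vertex r s merge (combine b i) (tgt k))
    ends≡ = trans (ends-remQuot r s merge e)
      (cong (λ a → vertex r s merge a (src k) , vertex r s merge a (tgt k)) (sym (combine-remQuot {r} s a)))

  labelling-antimagic : (∀ t t' → t ≢ t' → mergedDegree t ≢ mergedDegree t') →
                        LocalAntimagic G (labelling (r * s))
  labelling-antimagic distinct e with vsum-labelling-ends e
  ... | k , src≡ , tgt≡ = subst₂ _≢_ (sym src≡) (sym tgt≡) (distinct _ _ (class-proper k))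

  labelling-colours≤3 : colours G (labelling (r * s)) ≤ 3
  labelling-colours≤3 = colours≤ G (labelling (r * s)) (map mergedDegree (allFin 3)) λ e → λ
    { (here refl)         → let k , src≡ , _ = vsum-labelling-ends e in
                            subst (_∈ _) (sym src≡) (∈-map⁺ mergedDegree (∈-allFin (class (src k))))
    ; (there (here refl)) → let k , _ , tgt≡ = vsum-labelling-ends e in
                            subst (_∈ _) (sym tgt≡) (∈-map⁺ mergedDegree (∈-allFin (class (tgt k)))) }

  chiLa≡3 : ∀ N .{{_ : NonZero N}} →
            (∃ λ j → isMerged r s merge (evens j) ≡ true) → ∑[ j < 8 ] weight r s merge (evens j) ≡ N →
            (∃ λ j → isMerged r s merge (odds j) ≡ true) → ∑[ j < 8 ] weight r s merge (odds j) ≡ N →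
            Fin r → Fin s → (∀ t t' → t ≢ t' → mergedDegree t ≢ mergedDegree t') → ChiLaEq G 3
  chiLa≡3 N mergedE sizeE mergedO sizeO b i distinct =
    -- The lower bound for this very labelling turns at most three colours into exactly three.
    (labelling (r * s) , antimagic , ≤-antisym labelling-colours≤3 (lower (labelling (r * s)) antimagic)) , lower
    where
    antimagic = labelling-antimagic distinct
    lower : ∀ f → LocalAntimagic G f → 3 ≤ colours G f
    lower = colours≥3 r s merge N mergedE sizeE mergedO sizeO b i

-- Distinctness of the three colours, and the conclusion.

pairwise≢ : (d : Fin 3 → ℕ) → d 0F ≢ d 1F → d 0F ≢ d 2F → d 1F ≢ d 2F → ∀ t t' → t ≢ t' → d t ≢ d t'
pairwise≢ d p q u 0F 0F t≢t' = contradiction refl t≢t'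
pairwise≢ d p q u 0F 1F _    = p
pairwise≢ d p q u 0F 2F _    = q
pairwise≢ d p q u 1F 0F _    = p ∘ sym
pairwise≢ d p q u 1F 1F t≢t' = contradiction refl t≢t'
pairwise≢ d p q u 1F 2F _    = u
pairwise≢ d p q u 2F 0F _    = q ∘ sym
pairwise≢ d p q u 2F 1F _    = u ∘ sym
pairwise≢ d p q u 2F 2F t≢t' = contradiction refl t≢t'

degree₁<degree₂ : ∀ n → degree n 1F < degree n 2F
degree₁<degree₂ n = ≤-reflexive (sym (+-suc (30 * n) 1))

degree₀<degree₂ : ∀ n → degree n 0F < degree n 2F
degree₀<degree₂ n = subst (suc (20 * n + 1) ≤_) (eq n) (m≤m+n _ (10 * n))
  where eq : ∀ n → suc (20 * n + 1) + 10 * n ≡ 30 * n + 2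
        eq = solve-∀

-- Already 2 (20 n + 1) = 40 n + 2 exceeds 30 n + 2 for n ≥ 1.
degree₂<s*degree₀ : ∀ {s} → 2 ≤ s → ∀ n .{{_ : NonZero n}} → degree n 2F < s * degree n 0F
degree₂<s*degree₀ 2≤s (suc n) =
  ≤-trans (subst (suc (30 * suc n + 2) ≤_) (eq n) (m≤m+n _ (9 + 10 * n))) (*-monoˡ-≤ (degree (suc n) 0F) 2≤s)
  where eq : ∀ n → suc (30 * suc n + 2) + (9 + 10 * n) ≡ 2 * (20 * suc n + 1)
        eq = solve-∀

degree₂<s*degree₁ : ∀ {s} → 2 ≤ s → ∀ n .{{_ : NonZero n}} → degree n 2F < s * degree n 1F
degree₂<s*degree₁ {s} 2≤s n =
  <-≤-trans (degree₂<s*degree₀ 2≤s n) (*-monoʳ-≤ s (+-monoˡ-≤ 1 (*-monoˡ-≤ n (m≤m+n 20 10))))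

theorem3p3 : (r s : ℕ) → 1 ≤ r → 2 ≤ s → ChiLaEq (G₁ r s) 3 × ChiLaEq (G₂ r s) 3
theorem3p3 (suc _)   (suc zero)      _ (s≤s ())
theorem3p3 r@(suc _) s@(suc (suc _)) _ 2≤s =
  chiLa≡3 r s merge1 0F (from-yes (all? λ sd → all? λ i → merge1 sd i ≟ᵇ ⌊ class (sd , i) ≟ 0F ⌋))
    -- Each class has four merged positions and four with `s` vertices; u₀ and v₀ are merged.
    (4 + 4 * s) (0F , refl) refl (4F , refl) (odds₁ s) 0F 0F
    (pairwise≢ _ (>⇒≢ (<-trans (degree₁<degree₂ n) (degree₂<s*degree₀ 2≤s n)))
                 (>⇒≢ (degree₂<s*degree₀ 2≤s n))
                 (<⇒≢ (degree₁<degree₂ n))) ,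
  chiLa≡3 r s merge2 1F (from-yes (all? λ sd → all? λ i → merge2 sd i ≟ᵇ ⌊ class (sd , i) ≟ 1F ⌋))
    -- Each class has two merged positions and six with `s` vertices; v₃ and u₁ are merged.
    (2 + 6 * s) (6F , refl) (evens₂ s) (0F , refl) (odds₂ s) 0F 0F
    (pairwise≢ _ (<⇒≢ (<-trans (degree₀<degree₂ n) (degree₂<s*degree₁ 2≤s n)))
                 (<⇒≢ (degree₀<degree₂ n))
                 (>⇒≢ (degree₂<s*degree₁ 2≤s n)))
  where
  n = r * s
  odds₁ : ∀ s → s + (s + (s + (s + 4))) ≡ 4 + 4 * s
  odds₁ = solve-∀
  evens₂ : ∀ s → s + (s + (s + (s + (s + (s + 2))))) ≡ 2 + 6 * s
  evens₂ = solve-∀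
  odds₂ : ∀ s → 1 + (s + (s + (1 + (s + (s + (s + (s + 0))))))) ≡ 2 + 6 * s
  odds₂ = solve-∀
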